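{- Let $n,\overline{\alpha},\underline{s},m$ be integers with $n\ge 1$, $\overline{\alpha}\ge 2$, $1\le\underline{s}\le n$ and $m\ge 0$, and suppose that the optimal partition of $IPP_0(n,\overline{\alpha},m)$ has fewer than $\underline{s}$ nonzero parts. Then the optimal partition $\mathbf{a}^*(n,\overline{\alpha},\underline{s},m)$ of $IPP_{\Sigma M}(n,\overline{\alpha},\underline{s},m)$ is $$\mathbf{a}^*(n,\overline{\alpha},\underline{s},m)=\mathbf{a}_{1\times\underline{s}}\bullet\mathbf{a}^*_0(n-\underline{s},\overline{\alpha}-1,m),$$ where $\mathbf{a}_{1\times\underline{s}}=(\underbrace{1,\dots,1}_{\underline{s}})$ and $\mathbf{a}^*_0(n-\underline{s},\overline{\alpha}-1,m)$ is the optimal partition of $IPP_0(n-\underline{s},\overline{\alpha}-1,m)$. Consequently, $$\Sigma M(n,\overline{\alpha},\underline{s},m)=\frac{\underline{s}(\underline{s}+1)}{2}+\Sigma M_0(n-\underline{s},\overline{\alpha}-1,m).$$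
   Context: The problem $IPP_0(n,\overline{\alpha},m)$ is: minimize $f_{\Sigma M}(\mathbf{a})=\sum_{i=1}^n i\,a_i$ over all $\mathbf{a}=(a_i)_{1\le i\le n}\in\mathbb{N}^n$ (with $0\in\mathbb{N}$) such that $\sum_{i=1}^n a_i=n$; $a_i\ge a_{i+1}$ for $i=1,\dots,n-1$; $a_i\le\overline{\alpha}$ for all $i$; and $|\{i: a_i=\overline{\alpha}\}|\le m$. Its minimizer is called the optimal partition $\mathbf{a}^*_0(n,\overline{\alpha},m)$ and its minimum value is $\Sigma M_0(n,\overline{\alpha},m)$; for $n=0$ it is the empty partition with value $0$. The problem $IPP_{\Sigma M}(n,\overline{\alpha},\underline{s},m)$ is the same minimization problem as $IPP_0(n,\overline{\alpha},m)$ with the additional constraint $a_{\underline{s}}\ge 1$. Its minimizer is called the optimal partition $\mathbf{a}^*(n,\overline{\alpha},\underline{s},m)$ and its minimum value is $\Sigma M(n,\overline{\alpha},\underline{s},m)$. Partitions are extended by zeros when needed to match lengths, and $\bullet$ denotes line-by-line (entrywise) addition of two partitions. -}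

module Defs where

open import Data.Fin.Base using (toℕ)
open import Data.Nat using (ℕ; suc; _*_; _+_; _≤_; _≥_; _≟_)
open import Data.Product using (_×_; ∃-syntax)
open import Data.Vec.Base using (Vec; count; lookup; padRight; replicate; sum; tabulate; zipWith)
open import Data.Vec.Relation.Unary.All using (All)
open import Data.Vec.Relation.Unary.Linked using (Linked)
open import Relation.Binary.PropositionalEquality using (_≡_)
open import Relation.Nullary.Decidable using (¬?)

-- The part written aᵢ with 1 ≤ i ≤ n is  lookup a j  with  suc (toℕ j) ≡ i.

fΣM : ∀ {n} → Vec ℕ n → ℕ
fΣM a = sum (tabulate (λ j → suc (toℕ j) * lookup a j))

-- The number of parts and the integer being partitioned are both n.
record IPP₀ (n α m : ℕ) (a : Vec ℕ n) : Set where
  field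
    total      : sum a ≡ n
    decreasing : Linked _≥_ a
    bounded    : All (_≤ α) a
    maximal    : count (_≟ α) a ≤ m

record IPP (n α s m : ℕ) (a : Vec ℕ n) : Set where
  field
    feasible₀ : IPP₀ n α m a
    positive  : ∃[ j ] (suc (toℕ j) ≡ s × lookup a j ≥ 1)

-- A problem is given by its feasible set P; the objective is always fΣM.
module _ {n : ℕ} (P : Vec ℕ n → Set) where

  IsMinimizer : Vec ℕ n → Set
  IsMinimizer a = P a × (∀ b → P b → fΣM a ≤ fΣM b)

  -- "The" optimal partition: a minimizer, and the only one.
  IsOptimalPartition : Vec ℕ n → Set
  IsOptimalPartition a = IsMinimizer a × (∀ b → IsMinimizer b → b ≡ a)

  IsMinimumValue : ℕ → Set
  IsMinimumValue v = ∃[ a ] (IsMinimizer a × fΣM a ≡ v)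

nonzeroParts : ∀ {n} → Vec ℕ n → ℕ
nonzeroParts = count (λ x → ¬? (x ≟ 0))

ones : ∀ s → Vec ℕ s
ones s = replicate s 1

extend : ∀ {k n} → k ≤ n → Vec ℕ k → Vec ℕ n
extend k≤n = padRight k≤n 0

infixl 6 _•_

_•_ : ∀ {n} → Vec ℕ n → Vec ℕ n → Vec ℕ n
_•_ = zipWith _+_

{-# OPTIONS --safe #-}

-- Since Σ i aᵢ = (n + 1) Σ aᵢ − Σₖ (a₁ + ⋯ + aₖ), a feasible partition all of
-- whose prefix sums are maximal is the only optimal one.  Among partitions of r
-- into parts at most β + 1, of which at most m equal β + 1, the k-th prefix sum
-- is at most both r and  cap β m k = β k + min k m,  and the greedy partition
-- attains the minimum of the two.  If moreover the s-th part is positive, then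
-- a prefix of length k ≤ s leaves at least s − k for the rest.  Adding one to
-- the first s parts of the greedy partition of n − s attains that smaller bound
-- for k ≤ s; and for k ≥ s its prefix sum is n, because the assumption that
-- fewer than s nonzero parts can hold n says n ≤ cap (β + 1) m s = s + cap β m s.
module Submission where

open import Defs
open import Data.Fin.Base using (Fin; zero; suc; toℕ)
open import Data.Nat using (ℕ; zero; suc; pred; _+_; _*_; _∸_; _⊓_; _≤_; _≥_; _<_; _/_; _≟_; z≤n; s≤s; s≤s⁻¹)
open import Data.Nat.DivMod using (m*n/n≡m)
open import Data.Nat.Properties
open import Data.Nat.Tactic.RingSolver using (solve-∀)
open import Data.Product using (_×_; _,_; proj₁; ∃-syntax)
open import Data.Sum.Base using (inj₁; inj₂)
open import Data.Vec.Base using (Vec; []; _∷_; count; lookup; replicate; sum; tabulate)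
open import Data.Vec.Properties using (tabulate∘lookup)
open import Data.Vec.Relation.Unary.All using (All; []; _∷_)
open import Data.Vec.Relation.Unary.Linked as Linked using (Linked; []; [-]; _∷_)
open import Data.Vec.Relation.Unary.Linked.Properties using (lookup⁺)
open import Function.Base using (flip)
open import Relation.Binary.PropositionalEquality using (_≡_; _≢_; refl; sym; trans; cong; cong₂; subst; module ≡-Reasoning)
open import Relation.Nullary using (¬_; yes; no; contradiction)
open import Relation.Unary using (Pred; Decidable)
open import Algebra.Properties.CommutativeSemigroup +-commutativeSemigroup using (interchange)

private
  variable
    n k : ℕ

-- Counting and finite sums

module _ {p} {P : Pred ℕ p} (P? : Decidable P) where

  count-accept : ∀ {x} (v : Vec ℕ n) → P x → count P? (x ∷ v) ≡ suc (count P? v)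
  count-accept {x = x} v px with P? x
  ... | yes _  = refl
  ... | no ¬px = contradiction px ¬px

  count-reject : ∀ {x} (v : Vec ℕ n) → ¬ P x → count P? (x ∷ v) ≡ count P? v
  count-reject {x = x} v ¬px with P? x
  ... | yes px = contradiction px ¬px
  ... | no _   = refl

  count-∷-≤ : ∀ x (v : Vec ℕ n) → count P? (x ∷ v) ≤ suc (count P? v)
  count-∷-≤ x v with P? x
  ... | yes _ = ≤-refl
  ... | no _  = n≤1+n _

sum-tabulate-+ : (f g : Fin n → ℕ) →
                 sum (tabulate (λ j → f j + g j)) ≡ sum (tabulate f) + sum (tabulate g)
sum-tabulate-+ {zero}  f g = refl
sum-tabulate-+ {suc n} f g = begin
  f zero + g zero + sum (tabulate (λ j → f (suc j) + g (suc j)))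
    ≡⟨ cong (f zero + g zero +_) (sum-tabulate-+ (λ j → f (suc j)) (λ j → g (suc j))) ⟩
  f zero + g zero + (sum (tabulate (λ j → f (suc j))) + sum (tabulate (λ j → g (suc j))))
    ≡⟨ interchange (f zero) (g zero) _ _ ⟩
  f zero + sum (tabulate (λ j → f (suc j))) + (g zero + sum (tabulate (λ j → g (suc j)))) ∎
  where open ≡-Reasoning

sum-tabulate-const : ∀ n x → sum (tabulate {n = n} (λ _ → x)) ≡ n * x
sum-tabulate-const zero    x = refl
sum-tabulate-const (suc n) x = cong (x +_) (sum-tabulate-const n x)

sum-tabulate-mono : {f g : Fin n → ℕ} → (∀ j → f j ≤ g j) → sum (tabulate f) ≤ sum (tabulate g)
sum-tabulate-mono {zero}  f≤g = z≤n
sum-tabulate-mono {suc n} f≤g = +-mono-≤ (f≤g zero) (sum-tabulate-mono (λ j → f≤g (suc j)))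

-- Termwise inequalities leave no slack once the totals are reversed: cancelling the tails compares
-- the heads, and cancelling the heads compares the tails. This turns equality of totals into
-- equality of all prefix sums.
sum-tabulate-antisym : {f g : Fin n → ℕ} → (∀ j → f j ≤ g j) →
                       sum (tabulate g) ≤ sum (tabulate f) → ∀ j → f j ≡ g j
sum-tabulate-antisym {suc n} {f} {g} f≤g Σg≤Σf = λ where
    zero    → ≤-antisym (f≤g zero)
                (+-cancelʳ-≤ G (g zero) (f zero) (≤-trans Σg≤Σf (+-monoʳ-≤ (f zero) F≤G)))
    (suc j) → sum-tabulate-antisym (λ i → f≤g (suc i))
                (+-cancelˡ-≤ (g zero) G F (≤-trans Σg≤Σf (+-monoˡ-≤ F (f≤g zero)))) j
  where
  F G : ℕ
  F = sum (tabulate (λ j → f (suc j)))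
  G = sum (tabulate (λ j → g (suc j)))
  F≤G : F ≤ G
  F≤G = sum-tabulate-mono (λ j → f≤g (suc j))

-- Prefix sums and the objective

-- Total in the length: past the end the value stays at the full sum, so vectors of different
-- lengths can be compared at every `k`.
prefixSum : Vec ℕ n → ℕ → ℕ
prefixSum []      _       = 0
prefixSum (x ∷ v) zero    = 0
prefixSum (x ∷ v) (suc k) = x + prefixSum v k

prefixSum-0 : (v : Vec ℕ n) → prefixSum v 0 ≡ 0
prefixSum-0 []      = refl
prefixSum-0 (x ∷ v) = refl

prefixSum≤sum : (v : Vec ℕ n) → ∀ k → prefixSum v k ≤ sum v
prefixSum≤sum []      k       = z≤n
prefixSum≤sum (x ∷ v) zero    = z≤n
prefixSum≤sum (x ∷ v) (suc k) = +-monoʳ-≤ x (prefixSum≤sum v k)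

prefixSum-injective : (v w : Vec ℕ n) →
                      (∀ (j : Fin n) → prefixSum v (suc (toℕ j)) ≡ prefixSum w (suc (toℕ j))) → v ≡ w
prefixSum-injective []      []      eq = refl
prefixSum-injective (x ∷ v) (y ∷ w) eq =
  cong₂ _∷_ x≡y (prefixSum-injective v w (λ j →
    +-cancelˡ-≡ y _ _ (trans (cong (_+ prefixSum v _) (sym x≡y)) (eq (suc j)))))
  where
  x≡y : x ≡ y
  -- The prefix of length 1 is `x + prefixSum v 0`, which reduces no further while `v` is a
  -- variable; hence the detour through `prefixSum-0`.
  x≡y = +-cancelʳ-≡ 0 x y
    (trans (cong (x +_) (sym (prefixSum-0 v))) (trans (eq zero) (cong (y +_) (prefixSum-0 w))))

prefixSum-• : (v w : Vec ℕ n) → ∀ k → prefixSum (v • w) k ≡ prefixSum v k + prefixSum w k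
prefixSum-• []      []      k       = refl
prefixSum-• (x ∷ v) (y ∷ w) zero    = refl
prefixSum-• (x ∷ v) (y ∷ w) (suc k) =
  trans (cong (x + y +_) (prefixSum-• v w k)) (interchange x y _ _)

prefixSum-extend : (k≤n : k ≤ n) (v : Vec ℕ k) → ∀ i → prefixSum (extend k≤n v) i ≡ prefixSum v i
prefixSum-extend {n = zero}  z≤n       []      i       = refl
prefixSum-extend {n = suc n} z≤n       []      zero    = refl
prefixSum-extend {n = suc n} z≤n       []      (suc i) = prefixSum-extend {n = n} z≤n [] i
prefixSum-extend             (s≤s k≤n) (x ∷ v) zero    = refl
prefixSum-extend             (s≤s k≤n) (x ∷ v) (suc i) = cong (x +_) (prefixSum-extend k≤n v i)

prefixSum-ones : ∀ s k → prefixSum (ones s) k ≡ k ⊓ s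
prefixSum-ones zero    k       = sym (⊓-zeroʳ k)
prefixSum-ones (suc s) zero    = refl
prefixSum-ones (suc s) (suc k) = cong suc (prefixSum-ones s k)

-- Prepending a part moves every later part up one index, which costs one further `sum v`.
fΣM-∷ : ∀ x (v : Vec ℕ n) → fΣM (x ∷ v) ≡ x + (sum v + fΣM v)
fΣM-∷ x v = cong₂ _+_ (+-identityʳ x)
  (trans (sum-tabulate-+ (lookup v) (λ j → suc (toℕ j) * lookup v j))
         (cong (λ w → sum w + fΣM v) (tabulate∘lookup v)))

ΣprefixSum : Vec ℕ n → ℕ
ΣprefixSum {n} v = sum (tabulate {n = n} (λ j → prefixSum v (suc (toℕ j))))

ΣprefixSum-∷ : ∀ x (v : Vec ℕ n) → ΣprefixSum (x ∷ v) ≡ suc n * x + ΣprefixSum v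
ΣprefixSum-∷ {n} x v = begin
  ΣprefixSum (x ∷ v)
    ≡⟨ sum-tabulate-+ {suc n} (λ _ → x) (λ j → prefixSum v (toℕ j)) ⟩
  sum (tabulate {n = suc n} (λ _ → x)) + (prefixSum v 0 + ΣprefixSum v)
    ≡⟨ cong₂ _+_ (sum-tabulate-const (suc n) x) (cong (_+ ΣprefixSum v) (prefixSum-0 v)) ⟩
  suc n * x + ΣprefixSum v ∎
  where open ≡-Reasoning

-- The i-th part is weighted i in the objective and lies in n + 1 - i of the prefixes, so together
-- it is counted n + 1 times.
fΣM+ΣprefixSum : (v : Vec ℕ n) → fΣM v + ΣprefixSum v ≡ suc n * sum v
fΣM+ΣprefixSum []              = refl
fΣM+ΣprefixSum {suc n} (x ∷ v) = begin
  fΣM (x ∷ v) + ΣprefixSum (x ∷ v)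
    ≡⟨ cong₂ _+_ (fΣM-∷ x v) (ΣprefixSum-∷ x v) ⟩
  x + (sum v + fΣM v) + (suc n * x + ΣprefixSum v)
    ≡⟨ regroup x (sum v) (fΣM v) (suc n * x) (ΣprefixSum v) ⟩
  x + suc n * x + (sum v + (fΣM v + ΣprefixSum v))
    ≡⟨ cong (λ y → x + suc n * x + (sum v + y)) (fΣM+ΣprefixSum v) ⟩
  suc (suc n) * x + suc (suc n) * sum v
    ≡⟨ *-distribˡ-+ (suc (suc n)) x (sum v) ⟨
  suc (suc n) * (x + sum v) ∎
  where
  open ≡-Reasoning
  regroup : ∀ x s f y p → x + (s + f) + (y + p) ≡ x + y + (s + (f + p))
  regroup = solve-∀

-- Optimality from maximal prefix sums

module _ {P : Vec ℕ n → Set} {t : ℕ} (total : ∀ b → P b → sum b ≡ t) where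

  private
    balance : ∀ {a b} → P a → P b → fΣM a + ΣprefixSum a ≡ fΣM b + ΣprefixSum b
    balance {a} {b} pa pb = begin
      fΣM a + ΣprefixSum a ≡⟨ fΣM+ΣprefixSum a ⟩
      suc n * sum a        ≡⟨ cong (suc n *_) (trans (total a pa) (sym (total b pb))) ⟩
      suc n * sum b        ≡⟨ fΣM+ΣprefixSum b ⟨
      fΣM b + ΣprefixSum b ∎
      where open ≡-Reasoning

    exchange : ∀ {u v x y} → u + x ≡ v + y → y ≤ x → u ≤ v
    exchange {u} {v} {x} {y} eq y≤x = +-cancelʳ-≤ y u v (≤-trans (+-monoʳ-≤ u y≤x) (≤-reflexive eq))

  -- With a fixed total, `balance` makes a larger sum of prefix sums the same as a smaller
  -- objective.
  dominating⇒optimal : ∀ {a} → P a → (∀ b → P b → ∀ k → prefixSum b k ≤ prefixSum a k) →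
                       IsOptimalPartition P a
  dominating⇒optimal {a} pa dom = (pa , minimal) , unique
    where
    minimal : ∀ b → P b → fΣM a ≤ fΣM b
    minimal b pb = exchange (balance pa pb) (sum-tabulate-mono {n} (λ j → dom b pb (suc (toℕ j))))

    unique : ∀ b → IsMinimizer P b → b ≡ a
    unique b (pb , b-minimal) =
      -- Minimality of `b` forces its prefix sums to add up to at least those of `a`; being
      -- dominated termwise, they all coincide. `flipped` puts the prefix sums first so that
      -- `exchange` compares them.
      prefixSum-injective b a (sum-tabulate-antisym {n} (λ j → dom b pb (suc (toℕ j)))
        (exchange (flipped (balance pb pa)) (b-minimal a pa)))
      where
      flipped : fΣM b + ΣprefixSum b ≡ fΣM a + ΣprefixSum a →
                ΣprefixSum a + fΣM a ≡ ΣprefixSum b + fΣM b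
      flipped eq = trans (+-comm (ΣprefixSum a) _) (trans (sym eq) (+-comm _ (ΣprefixSum b)))

-- Upper bounds for prefix sums

cap : (β m k : ℕ) → ℕ
cap β m k = β * k + k ⊓ m

cap-0 : ∀ β m → cap β m 0 ≡ 0
cap-0 β m = cong (_+ 0) (*-zeroʳ β)

cap-mono : ∀ β {m m′ k k′} → m ≤ m′ → k ≤ k′ → cap β m k ≤ cap β m′ k′
cap-mono β m≤m′ k≤k′ = +-mono-≤ (*-monoʳ-≤ β k≤k′) (⊓-mono-≤ k≤k′ m≤m′)

-- Raising the bound on parts by one makes room for one more unit in each of `k` parts: the
-- numerical shadow of adding the row of ones.
cap-sucˡ : ∀ β m k → cap (suc β) m k ≡ k + cap β m k
cap-sucˡ β m k = +-assoc k (β * k) (k ⊓ m)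

cap-suc-suc : ∀ β m k → cap β (suc m) (suc k) ≡ suc β + cap β m k
cap-suc-suc β m k = identity β k (k ⊓ m)
  where
  identity : ∀ β k c → β * suc k + suc c ≡ suc β + (β * k + c)
  identity = solve-∀

+-cap≤cap-suc : ∀ {β x} m k → x ≤ β → x + cap β m k ≤ cap β m (suc k)
+-cap≤cap-suc {β} {x} m k x≤β = begin
  x + (β * k + k ⊓ m)     ≤⟨ +-monoˡ-≤ _ x≤β ⟩
  β + (β * k + k ⊓ m)     ≡⟨ +-assoc β (β * k) _ ⟨
  β + β * k + k ⊓ m       ≡⟨ cong (_+ k ⊓ m) (*-suc β k) ⟨
  β * suc k + k ⊓ m       ≤⟨ +-monoʳ-≤ (β * suc k) (⊓-monoˡ-≤ m (n≤1+n k)) ⟩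
  cap β m (suc k)         ∎
  where open ≤-Reasoning

-- The exact count stands in place of `m` so that the induction can lower it by one at each maximal
-- entry; any other entry contributes at most `β`.
prefixSum≤cap : ∀ β (v : Vec ℕ n) → All (_≤ suc β) v →
                ∀ k → prefixSum v k ≤ cap β (count (_≟ suc β) v) k
prefixSum≤cap β []      []           k       = z≤n
prefixSum≤cap β (x ∷ v) (x≤ ∷ v≤)    zero    = z≤n
prefixSum≤cap β (x ∷ v) (x≤ ∷ v≤)    (suc k) with x ≟ suc β
... | yes refl = begin
  suc β + prefixSum v k                      ≤⟨ +-monoʳ-≤ (suc β) (prefixSum≤cap β v v≤ k) ⟩
  suc β + cap β (count (_≟ suc β) v) k       ≡⟨ cap-suc-suc β _ k ⟨
  cap β (suc (count (_≟ suc β) v)) (suc k)   ≡⟨ cong (λ c → cap β c (suc k)) (count-accept (_≟ suc β) v refl) ⟨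
  cap β (count (_≟ suc β) (x ∷ v)) (suc k)   ∎
  where open ≤-Reasoning
... | no x≢ = begin
  x + prefixSum v k                          ≤⟨ +-monoʳ-≤ x (prefixSum≤cap β v v≤ k) ⟩
  x + cap β (count (_≟ suc β) v) k           ≤⟨ +-cap≤cap-suc _ k (s≤s⁻¹ (≤∧≢⇒< x≤ x≢)) ⟩
  cap β (count (_≟ suc β) v) (suc k)         ≡⟨ cong (λ c → cap β c (suc k)) (count-reject (_≟ suc β) v x≢) ⟨
  cap β (count (_≟ suc β) (x ∷ v)) (suc k)   ∎
  where open ≤-Reasoning

-- A zero entry changes neither side, so the bound depends on the number of nonzero parts instead of
-- the length. This is how the assumption of few nonzero parts becomes an inequality.
sum≤cap-nonzeroParts : ∀ β (v : Vec ℕ n) → All (_≤ suc β) v →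
                       sum v ≤ cap β (count (_≟ suc β) v) (nonzeroParts v)
sum≤cap-nonzeroParts β []          []        = z≤n
sum≤cap-nonzeroParts β (zero  ∷ v) (x≤ ∷ v≤) = sum≤cap-nonzeroParts β v v≤
sum≤cap-nonzeroParts β (suc x ∷ v) (x≤ ∷ v≤) with suc x ≟ suc β
... | yes refl = begin
  suc β + sum v                                   ≤⟨ +-monoʳ-≤ (suc β) (sum≤cap-nonzeroParts β v v≤) ⟩
  suc β + cap β (count (_≟ suc β) v) (nonzeroParts v) ≡⟨ cap-suc-suc β _ (nonzeroParts v) ⟨
  cap β (suc (count (_≟ suc β) v)) (suc (nonzeroParts v))
    ≡⟨ cong (λ c → cap β c (suc (nonzeroParts v))) (count-accept (_≟ suc β) v refl) ⟨
  cap β (count (_≟ suc β) (suc x ∷ v)) (suc (nonzeroParts v)) ∎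
  where open ≤-Reasoning
... | no x≢ = begin
  suc x + sum v                                   ≤⟨ +-monoʳ-≤ (suc x) (sum≤cap-nonzeroParts β v v≤) ⟩
  suc x + cap β (count (_≟ suc β) v) (nonzeroParts v) ≤⟨ +-cap≤cap-suc _ (nonzeroParts v) (s≤s⁻¹ (≤∧≢⇒< x≤ x≢)) ⟩
  cap β (count (_≟ suc β) v) (suc (nonzeroParts v))
    ≡⟨ cong (λ c → cap β c (suc (nonzeroParts v))) (count-reject (_≟ suc β) v x≢) ⟨
  cap β (count (_≟ suc β) (suc x ∷ v)) (suc (nonzeroParts v)) ∎
  where open ≤-Reasoning

positive⇒≤sum : (v : Vec ℕ n) → Linked _≥_ v → (j : Fin n) → lookup v j ≥ 1 → suc (toℕ j) ≤ sum v
positive⇒≤sum (x ∷ v) dec zero    pos = m≤n⇒m≤n+o (sum v) pos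
positive⇒≤sum (x ∷ v) dec (suc j) pos =
  -- The head is at least the later positive part, hence at least 1.
  +-mono-≤ (≤-trans pos (lookup⁺ (flip ≤-trans) {i = zero} dec (s≤s z≤n)))
           (positive⇒≤sum v (Linked.tail dec) j pos)

-- Each position after the prefix, up to the positive one, still holds at least 1. Truncated
-- subtraction covers prefixes that already reach it.
prefixSum+∸≤sum : (v : Vec ℕ n) → Linked _≥_ v → (j : Fin n) → lookup v j ≥ 1 →
                  ∀ k → prefixSum v k + (suc (toℕ j) ∸ k) ≤ sum v
prefixSum+∸≤sum v@(_ ∷ _) dec j       pos zero    = positive⇒≤sum v dec j pos
prefixSum+∸≤sum v@(_ ∷ _) dec zero    pos (suc k) =
  ≤-trans (≤-reflexive (trans (cong (prefixSum v (suc k) +_) (0∸n≡0 k)) (+-identityʳ _)))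
          (prefixSum≤sum v (suc k))
prefixSum+∸≤sum (x ∷ v)   dec (suc j) pos (suc k) =
  ≤-trans (≤-reflexive (+-assoc x (prefixSum v k) _))
          (+-monoʳ-≤ x (prefixSum+∸≤sum v (Linked.tail dec) j pos k))

-- The greedy partition

-- The largest part still available when `m` more copies of `suc β` are allowed.
largest : (β m : ℕ) → ℕ
largest β zero    = β
largest β (suc m) = suc β

largest≤ : ∀ β m → largest β m ≤ suc β
largest≤ β zero    = n≤1+n β
largest≤ β (suc m) = ≤-refl

largest-pred : ∀ β m → largest β (pred m) ≤ largest β m
largest-pred β zero    = ≤-refl
largest-pred β (suc m) = largest≤ β m

-- Splits off the first part, as the recursion of `greedy` does; `pred` leaves an exhausted
-- allowance at 0.
cap-suc : ∀ β m k → cap β m (suc k) ≡ largest β m + cap β (pred m) k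
cap-suc β zero    k = begin
  β * suc k + 0       ≡⟨ cong (_+ 0) (*-suc β k) ⟩
  β + β * k + 0       ≡⟨ +-assoc β (β * k) 0 ⟩
  β + (β * k + 0)     ≡⟨ cong (λ c → β + (β * k + c)) (⊓-zeroʳ k) ⟨
  β + cap β 0 k       ∎
  where open ≡-Reasoning
cap-suc β (suc m) k = cap-suc-suc β m k

-- The length `l` is separate from the amount `r` because they shrink at different rates; once the
-- amount is used up, the remaining parts are 0.
greedy : (β m l r : ℕ) → Vec ℕ l
greedy β m zero    r = []
greedy β m (suc l) r = r ⊓ largest β m ∷ greedy β (pred m) l (r ∸ largest β m)

-- Taking up to `c` and then up to `d` from a stock of `r` removes as much as taking up to `c + d`
-- at once.
⊓-+-split : ∀ r c d → r ⊓ c + (r ∸ c) ⊓ d ≡ r ⊓ (c + d)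
⊓-+-split zero    c       d = cong (_⊓ d) (0∸n≡0 c)
⊓-+-split (suc r) zero    d = refl
⊓-+-split (suc r) (suc c) d = cong suc (⊓-+-split r c d)

remainder-fits : ∀ β m l r → r ≤ cap β m (suc l) → r ∸ largest β m ≤ cap β (pred m) l
remainder-fits β m l r r≤ = m≤n+o⇒m∸n≤o r (largest β m) (subst (r ≤_) (cap-suc β m l) r≤)

prefixSum-greedy : ∀ β m l r → r ≤ cap β m l → ∀ k → prefixSum (greedy β m l r) k ≡ r ⊓ cap β m k
-- Without parts the bound forces `r` to be 0, so both sides vanish for every `k`, even beyond the
-- length.
prefixSum-greedy β m zero    r r≤ k with n≤0⇒n≡0 (≤-trans r≤ (≤-reflexive (cap-0 β m)))
... | refl = refl
prefixSum-greedy β m (suc l) r r≤ zero = sym (trans (cong (r ⊓_) (cap-0 β m)) (⊓-zeroʳ r))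
prefixSum-greedy β m (suc l) r r≤ (suc k) = begin
  r ⊓ c + prefixSum (greedy β (pred m) l (r ∸ c)) k
    ≡⟨ cong (r ⊓ c +_) (prefixSum-greedy β (pred m) l (r ∸ c) (remainder-fits β m l r r≤) k) ⟩
  r ⊓ c + (r ∸ c) ⊓ cap β (pred m) k   ≡⟨ ⊓-+-split r c _ ⟩
  r ⊓ (c + cap β (pred m) k)           ≡⟨ cong (r ⊓_) (cap-suc β m k) ⟨
  r ⊓ cap β m (suc k)                  ∎
  where
  open ≡-Reasoning
  c = largest β m

sum-greedy : ∀ β m l r → r ≤ cap β m l → sum (greedy β m l r) ≡ r
sum-greedy β m zero    r r≤ = sym (n≤0⇒n≡0 (≤-trans r≤ (≤-reflexive (cap-0 β m))))
sum-greedy β m (suc l) r r≤ = begin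
  r ⊓ c + sum (greedy β (pred m) l (r ∸ c)) ≡⟨ cong (r ⊓ c +_) (sum-greedy β (pred m) l (r ∸ c) (remainder-fits β m l r r≤)) ⟩
  r ⊓ c + (r ∸ c)                           ≡⟨ cong (_+ (r ∸ c)) (⊓-comm r c) ⟩
  c ⊓ r + (r ∸ c)                           ≡⟨ m⊓n+n∸m≡n c r ⟩
  r                                         ∎
  where
  open ≡-Reasoning
  c = largest β m

greedy-decreasing : ∀ β m l r → Linked _≥_ (greedy β m l r)
greedy-decreasing β m zero          r = []
greedy-decreasing β m (suc zero)    r = [-]
greedy-decreasing β m (suc (suc l)) r =
  ⊓-glb (≤-trans (m⊓n≤m _ _) (m∸n≤m r (largest β m)))
        (≤-trans (m⊓n≤n (r ∸ largest β m) _) (largest-pred β m))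
  ∷ greedy-decreasing β (pred m) (suc l) (r ∸ largest β m)

greedy-bounded : ∀ β m l r → All (_≤ suc β) (greedy β m l r)
greedy-bounded β m zero    r = []
greedy-bounded β m (suc l) r = ≤-trans (m⊓n≤n r _) (largest≤ β m) ∷ greedy-bounded β (pred m) l _

greedy-maximal : ∀ β m l r → count (_≟ suc β) (greedy β m l r) ≤ m
greedy-maximal β m       zero    r = z≤n
-- With no allowance left the head is at most `β`, so it is not counted.
greedy-maximal β zero    (suc l) r =
  ≤-trans (≤-reflexive (count-reject (_≟ suc β) (greedy β 0 l _)
            (λ eq → <-irrefl eq (s≤s (m⊓n≤n r β)))))
          (greedy-maximal β zero l _)
greedy-maximal β (suc m) (suc l) r =
  ≤-trans (count-∷-≤ (_≟ suc β) (r ⊓ suc β) (greedy β m l _)) (s≤s (greedy-maximal β m l _))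

-- The bound excludes exactly the case of `β` equal to 0 with `m` below `r`, where parts are at most
-- 1 and too few ones are permitted.
greedy-feasible : ∀ β m r → r ≤ cap β m r → IPP₀ r (suc β) m (greedy β m r r)
greedy-feasible β m r r≤ = record
  { total      = sum-greedy β m r r r≤
  ; decreasing = greedy-decreasing β m r r
  ; bounded    = greedy-bounded β m r r
  ; maximal    = greedy-maximal β m r r
  }

IPP₀-prefixSum≤cap : ∀ {β m} {v : Vec ℕ n} → IPP₀ n (suc β) m v → ∀ k → prefixSum v k ≤ cap β m k
IPP₀-prefixSum≤cap {β = β} {v = v} feasible k =
  ≤-trans (prefixSum≤cap β v bounded k) (cap-mono β maximal ≤-refl)
  where open IPP₀ feasible

greedy-optimal : ∀ β m r → r ≤ cap β m r → IsOptimalPartition (IPP₀ r (suc β) m) (greedy β m r r)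
greedy-optimal β m r r≤ = dominating⇒optimal (λ _ → IPP₀.total) (greedy-feasible β m r r≤) λ b feasible k →
  ≤-trans (⊓-glb (≤-trans (prefixSum≤sum b k) (≤-reflexive (IPP₀.total feasible)))
                 (IPP₀-prefixSum≤cap feasible k))
          (≤-reflexive (sym (prefixSum-greedy β m r r r≤ k)))

-- Extension and addition of partitions

sum-• : (v w : Vec ℕ n) → sum (v • w) ≡ sum v + sum w
sum-• []      []      = refl
sum-• (x ∷ v) (y ∷ w) = trans (cong (x + y +_) (sum-• v w)) (interchange x y (sum v) (sum w))

sum-extend : (k≤n : k ≤ n) (v : Vec ℕ k) → sum (extend k≤n v) ≡ sum v
sum-extend {n = zero}  z≤n       []      = refl
sum-extend {n = suc n} z≤n       []      = sum-extend {n = n} z≤n []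
sum-extend             (s≤s k≤n) (x ∷ v) = cong (x +_) (sum-extend k≤n v)

sum-ones : ∀ s → sum (ones s) ≡ s
sum-ones zero    = refl
sum-ones (suc s) = cong suc (sum-ones s)

fΣM-• : (v w : Vec ℕ n) → fΣM (v • w) ≡ fΣM v + fΣM w
fΣM-• []      []      = refl
fΣM-• (x ∷ v) (y ∷ w) = begin
  fΣM ((x + y) ∷ (v • w))                         ≡⟨ fΣM-∷ (x + y) (v • w) ⟩
  x + y + (sum (v • w) + fΣM (v • w))             ≡⟨ cong (x + y +_) (cong₂ _+_ (sum-• v w) (fΣM-• v w)) ⟩
  x + y + (sum v + sum w + (fΣM v + fΣM w))       ≡⟨ regroup x y (sum v) (sum w) (fΣM v) (fΣM w) ⟩
  x + (sum v + fΣM v) + (y + (sum w + fΣM w))     ≡⟨ cong₂ _+_ (fΣM-∷ x v) (fΣM-∷ y w) ⟨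
  fΣM (x ∷ v) + fΣM (y ∷ w)                       ∎
  where
  open ≡-Reasoning
  regroup : ∀ x y s t f g → x + y + (s + t + (f + g)) ≡ x + (s + f) + (y + (t + g))
  regroup = solve-∀

fΣM-extend : (k≤n : k ≤ n) (v : Vec ℕ k) → fΣM (extend k≤n v) ≡ fΣM v
fΣM-extend {n = zero}  z≤n []            = refl
fΣM-extend {n = suc n} z≤n []            =
  trans (fΣM-∷ 0 (replicate n 0)) (cong₂ _+_ (sum-extend {n = n} z≤n []) (fΣM-extend {n = n} z≤n []))
fΣM-extend             (s≤s k≤n) (x ∷ v) = begin
  fΣM (x ∷ extend k≤n v)                          ≡⟨ fΣM-∷ x (extend k≤n v) ⟩
  x + (sum (extend k≤n v) + fΣM (extend k≤n v))   ≡⟨ cong (x +_) (cong₂ _+_ (sum-extend k≤n v) (fΣM-extend k≤n v)) ⟩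
  x + (sum v + fΣM v)                             ≡⟨ fΣM-∷ x v ⟨
  fΣM (x ∷ v)                                     ∎
  where open ≡-Reasoning

-- Division of naturals truncates, so the identity is first proved doubled, by induction, and then
-- divided exactly.
fΣM-ones : ∀ s → fΣM (ones s) ≡ s * (s + 1) / 2
fΣM-ones s = trans (sym (m*n/n≡m (fΣM (ones s)) 2)) (cong (_/ 2) (doubled s))
  where
  open ≡-Reasoning
  expand : ∀ s f → (1 + (s + f)) * 2 ≡ 2 + s * 2 + f * 2
  expand = solve-∀
  collect : ∀ s → 2 + s * 2 + s * (s + 1) ≡ suc s * (suc s + 1)
  collect = solve-∀
  doubled : ∀ s → fΣM (ones s) * 2 ≡ s * (s + 1)
  doubled zero    = refl
  doubled (suc s) = begin
    fΣM (ones (suc s)) * 2                   ≡⟨ cong (_* 2) (fΣM-∷ 1 (ones s)) ⟩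
    (1 + (sum (ones s) + fΣM (ones s))) * 2  ≡⟨ cong (λ t → (1 + (t + fΣM (ones s))) * 2) (sum-ones s) ⟩
    (1 + (s + fΣM (ones s))) * 2             ≡⟨ expand s (fΣM (ones s)) ⟩
    2 + s * 2 + fΣM (ones s) * 2             ≡⟨ cong (2 + s * 2 +_) (doubled s) ⟩
    2 + s * 2 + s * (s + 1)                  ≡⟨ collect s ⟩
    suc s * (suc s + 1)                      ∎

All-replicate : ∀ {p} {P : Pred ℕ p} {x} n → P x → All P (replicate n x)
All-replicate zero    px = []
All-replicate (suc n) px = px ∷ All-replicate n px

All-extend : ∀ {p} {P : Pred ℕ p} (k≤n : k ≤ n) {v : Vec ℕ k} → P 0 → All P v → All P (extend k≤n v)
All-extend z≤n       p0 []        = All-replicate _ p0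
All-extend (s≤s k≤n) p0 (px ∷ pv) = px ∷ All-extend k≤n p0 pv

replicate-decreasing : ∀ n x → Linked _≥_ (replicate n x)
replicate-decreasing zero          x = []
replicate-decreasing (suc zero)    x = [-]
replicate-decreasing (suc (suc n)) x = ≤-refl ∷ replicate-decreasing (suc n) x

extend-decreasing : (k≤n : k ≤ n) {v : Vec ℕ k} → Linked _≥_ v → Linked _≥_ (extend k≤n v)
extend-decreasing               z≤n             []          = replicate-decreasing _ 0
extend-decreasing {n = suc zero}    (s≤s z≤n)   [-]         = [-]
extend-decreasing {n = suc (suc n)} (s≤s z≤n)   [-]         = z≤n ∷ replicate-decreasing (suc n) 0
extend-decreasing (s≤s (s≤s k≤n)) {_ ∷ _ ∷ _}   (x≥ ∷ dec)  = x≥ ∷ extend-decreasing (s≤s k≤n) dec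

•-decreasing : {v w : Vec ℕ n} → Linked _≥_ v → Linked _≥_ w → Linked _≥_ (v • w)
•-decreasing []                             []                             = []
•-decreasing [-]                            [-]                            = [-]
•-decreasing {v = _ ∷ _ ∷ _} {_ ∷ _ ∷ _}    (x≥ ∷ v-dec)  (y≥ ∷ w-dec)     =
  +-mono-≤ x≥ y≥ ∷ •-decreasing v-dec w-dec

•-bounded : ∀ {c d} {v w : Vec ℕ n} → All (_≤ c) v → All (_≤ d) w → All (_≤ c + d) (v • w)
•-bounded {v = []}    {[]}    []        []        = []
•-bounded {v = _ ∷ _} {_ ∷ _} (x≤ ∷ v≤) (y≤ ∷ w≤) = +-mono-≤ x≤ y≤ ∷ •-bounded v≤ w≤

-- The counted value is a successor, so the padding zeros never contribute.
count-extend : ∀ α (k≤n : k ≤ n) (v : Vec ℕ k) → count (_≟ suc α) (extend k≤n v) ≡ count (_≟ suc α) v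
count-extend {n = zero}  α z≤n       []      = refl
count-extend {n = suc n} α z≤n       []      = count-extend {n = n} α z≤n []
count-extend             α (s≤s k≤n) (x ∷ v) with x ≟ suc α
... | yes x≡ = trans (count-accept (_≟ suc α) (extend k≤n v) x≡)
                 (trans (cong suc (count-extend α k≤n v)) (sym (count-accept (_≟ suc α) v x≡)))
... | no x≢  = trans (count-reject (_≟ suc α) (extend k≤n v) x≢)
                 (trans (count-extend α k≤n v) (sym (count-reject (_≟ suc α) v x≢)))

-- Adding at most 1 to an entry that is at most `β` reaches `suc β` only if that entry was `β`.
count-• : ∀ β {u v : Vec ℕ n} → All (_≤ 1) u → All (_≤ β) v →
          count (_≟ suc β) (u • v) ≤ count (_≟ β) v
count-• β {[]}    {[]}    []        []        = z≤n
count-• β {x ∷ u} {y ∷ v} (x≤ ∷ u≤) (y≤ ∷ v≤) with y ≟ β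
... | yes y≡ = begin
  count (_≟ suc β) ((x + y) ∷ (u • v)) ≤⟨ count-∷-≤ (_≟ suc β) (x + y) (u • v) ⟩
  suc (count (_≟ suc β) (u • v))       ≤⟨ s≤s (count-• β u≤ v≤) ⟩
  suc (count (_≟ β) v)                 ≡⟨ count-accept (_≟ β) v y≡ ⟨
  count (_≟ β) (y ∷ v)                 ∎
  where open ≤-Reasoning
... | no y≢ = begin
  count (_≟ suc β) ((x + y) ∷ (u • v)) ≡⟨ count-reject (_≟ suc β) (u • v) x+y≢ ⟩
  count (_≟ suc β) (u • v)             ≤⟨ count-• β u≤ v≤ ⟩
  count (_≟ β) v                       ≡⟨ count-reject (_≟ β) v y≢ ⟨
  count (_≟ β) (y ∷ v)                 ∎
  where
  open ≤-Reasoning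
  x+y≢ : x + y ≢ suc β
  x+y≢ eq = <-irrefl eq (s≤s (≤-trans (+-monoˡ-≤ y x≤) (≤∧≢⇒< y≤ y≢)))

extend-ones-•-positive : ∀ {s} → 1 ≤ s → (s≤n : s ≤ n) (w : Vec ℕ n) →
                         ∃[ j ] (suc (toℕ j) ≡ s × lookup (extend s≤n (ones s) • w) j ≥ 1)
extend-ones-•-positive {s = suc zero}    _ (s≤s z≤n) (y ∷ w) = zero , refl , s≤s z≤n
extend-ones-•-positive {s = suc (suc s)} _ (s≤s s≤n) (y ∷ w)
  with j , eq , pos ← extend-ones-•-positive (s≤s z≤n) s≤n w = suc j , cong suc eq , pos

-- The optimal partition with a positive `s`-th part

module _ (n β s m : ℕ) (1≤s : 1 ≤ s) (s≤n : s ≤ n) (n∸s≤cap : n ∸ s ≤ cap β m s) where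

  private
    r : ℕ
    r = n ∸ s

  -- A cap for s parts is one for r parts: β ≥ 1 already gives r ≤ cap β m r, and cap 0 m k = k ⊓ m.
  remainder≤cap : r ≤ cap β m r
  remainder≤cap = lemma β n∸s≤cap
    where
    lemma : ∀ β → r ≤ cap β m s → r ≤ cap β m r
    lemma zero    r≤ = ⊓-glb ≤-refl (≤-trans r≤ (m⊓n≤n s m))
    lemma (suc β) _  = ≤-trans (m≤m+n r (β * r)) (m≤m+n (suc β * r) (r ⊓ m))

  raisedGreedy : Vec ℕ n
  raisedGreedy = extend s≤n (ones s) • extend (m∸n≤m n s) (greedy β m r r)

  prefixSum-raisedGreedy : ∀ k → prefixSum raisedGreedy k ≡ k ⊓ s + r ⊓ cap β m k
  prefixSum-raisedGreedy k = trans
    (prefixSum-• (extend s≤n (ones s)) (extend (m∸n≤m n s) (greedy β m r r)) k)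
    (cong₂ _+_ (trans (prefixSum-extend s≤n (ones s) k) (prefixSum-ones s k))
               (trans (prefixSum-extend (m∸n≤m n s) (greedy β m r r) k)
                      (prefixSum-greedy β m r r remainder≤cap k)))

  raisedGreedy-feasible : IPP n (suc (suc β)) s m raisedGreedy
  raisedGreedy-feasible = record
    { feasible₀ = record
      { total      = trans (sum-• (extend s≤n (ones s)) _)
                       (trans (cong₂ _+_ (trans (sum-extend s≤n (ones s)) (sum-ones s))
                                         (trans (sum-extend (m∸n≤m n s) (greedy β m r r)) total))
                              (m+[n∸m]≡n s≤n))
      ; decreasing = •-decreasing (extend-decreasing s≤n (replicate-decreasing s 1))
                                  (extend-decreasing (m∸n≤m n s) decreasing)
      ; bounded    = •-bounded ones≤1 greedy≤
      -- Copies of the bound in the sum come from copies of `suc β` in the greedy partition, of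
      -- which there are at most `m`.
      ; maximal    = ≤-trans (count-• (suc β) ones≤1 greedy≤)
                       (≤-trans (≤-reflexive (count-extend β (m∸n≤m n s) (greedy β m r r))) maximal)
      }
    ; positive  = extend-ones-•-positive 1≤s s≤n _
    }
    where
    open IPP₀ (greedy-feasible β m r remainder≤cap)
    ones≤1 : All (_≤ 1) (extend s≤n (ones s))
    ones≤1 = All-extend s≤n z≤n (All-replicate s ≤-refl)
    greedy≤ : All (_≤ suc β) (extend (m∸n≤m n s) (greedy β m r r))
    greedy≤ = All-extend (m∸n≤m n s) z≤n bounded

  IPP-prefixSum≤ : ∀ {b} → IPP n (suc (suc β)) s m b → ∀ k → prefixSum b k ≤ k ⊓ s + r ⊓ cap β m k
  IPP-prefixSum≤ {b} feasible k with IPP.positive feasible | ≤-total k s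
  ... | j , refl , pos | inj₁ k≤s = begin
    prefixSum b k              ≤⟨ ⊓-glb ≤k+r ≤k+cap ⟩
    (k + r) ⊓ (k + cap β m k)  ≡⟨ +-distribˡ-⊓ k r (cap β m k) ⟨
    k + r ⊓ cap β m k          ≡⟨ cong (_+ r ⊓ cap β m k) (m≤n⇒m⊓n≡m k≤s) ⟨
    k ⊓ s + r ⊓ cap β m k      ∎
    where
    open ≤-Reasoning
    open IPP₀ (IPP.feasible₀ feasible)
    ≤k+cap : prefixSum b k ≤ k + cap β m k
    ≤k+cap = ≤-trans (IPP₀-prefixSum≤cap (IPP.feasible₀ feasible) k) (≤-reflexive (cap-sucˡ β m k))
    ≤k+r : prefixSum b k ≤ k + r
    -- The remaining `s ∸ k` units are reserved for positions after the prefix; removing them from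
    -- `n`, which is `s + r`, leaves `k + r`.
    ≤k+r = +-cancelʳ-≤ (s ∸ k) _ _ (begin
      prefixSum b k + (s ∸ k)  ≤⟨ prefixSum+∸≤sum b decreasing j pos k ⟩
      sum b                    ≡⟨ total ⟩
      n                        ≡⟨ m+[n∸m]≡n s≤n ⟨
      s + r                    ≡⟨ cong (_+ r) (m+[n∸m]≡n k≤s) ⟨
      k + (s ∸ k) + r          ≡⟨ swap k (s ∸ k) r ⟩
      k + r + (s ∸ k)          ∎)
      where
      swap : ∀ a b c → a + b + c ≡ a + c + b
      swap = solve-∀
  -- From `s` on the bound is `n` itself: `cap β m k` is at least `cap β m s`, hence at least `r`,
  -- and both minima resolve to `s` and `r`.
  ... | _ | inj₂ s≤k = begin
    prefixSum b k            ≤⟨ prefixSum≤sum b k ⟩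
    sum b                    ≡⟨ IPP₀.total (IPP.feasible₀ feasible) ⟩
    n                        ≡⟨ m+[n∸m]≡n s≤n ⟨
    s + r                    ≡⟨ cong₂ _+_ (m≥n⇒m⊓n≡n s≤k)
                                          (m≤n⇒m⊓n≡m (≤-trans n∸s≤cap (cap-mono β ≤-refl s≤k))) ⟨
    k ⊓ s + r ⊓ cap β m k    ∎
    where open ≤-Reasoning

  raisedGreedy-optimal : IsOptimalPartition (IPP n (suc (suc β)) s m) raisedGreedy
  raisedGreedy-optimal =
    dominating⇒optimal (λ _ feasible → IPP₀.total (IPP.feasible₀ feasible)) raisedGreedy-feasible
      λ b feasible k → ≤-trans (IPP-prefixSum≤ feasible k) (≤-reflexive (sym (prefixSum-raisedGreedy k)))

  fΣM-raisedGreedy : fΣM raisedGreedy ≡ s * (s + 1) / 2 + fΣM (greedy β m r r)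
  fΣM-raisedGreedy = trans
    (fΣM-• (extend s≤n (ones s)) (extend (m∸n≤m n s) (greedy β m r r)))
    (cong₂ _+_ (trans (fΣM-extend s≤n (ones s)) (fΣM-ones s)) (fΣM-extend (m∸n≤m n s) (greedy β m r r)))

theorem6 : ∀ (n α s m : ℕ) → 1 ≤ n → 2 ≤ α → 1 ≤ s → (s≤n : s ≤ n) →
    (a₀ : Vec ℕ n) → IsMinimizer (IPP₀ n α m) a₀ → nonzeroParts a₀ < s →
    (∃[ b ] (IsOptimalPartition (IPP₀ (n ∸ s) (α ∸ 1) m) b ×
    IsOptimalPartition (IPP n α s m) (extend s≤n (ones s) • extend (m∸n≤m n s) b))) ×
    (∃[ v ] (IsMinimumValue (IPP₀ (n ∸ s) (α ∸ 1) m) v ×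
    IsMinimumValue (IPP n α s m) (s * (s + 1) / 2 + v)))
theorem6 n (suc (suc β)) s m _ (s≤s (s≤s z≤n)) 1≤s s≤n a₀ (feasible , _) short =
  (g , g-optimal , t-optimal) ,
  (fΣM g , (g , proj₁ g-optimal , refl) ,
           (_ , proj₁ t-optimal , fΣM-raisedGreedy n β s m 1≤s s≤n n∸s≤cap))
  where
  open IPP₀ feasible
  n∸s≤cap : n ∸ s ≤ cap β m s
  -- Feasibility of `a₀` with fewer than `s` nonzero parts shows that `s` parts can hold `n`; one
  -- unit from each of them accounts for the subtracted `s`.
  n∸s≤cap = m≤n+o⇒m∸n≤o n s (begin
    n                                                       ≡⟨ total ⟨
    sum a₀                                                  ≤⟨ sum≤cap-nonzeroParts (suc β) a₀ bounded ⟩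
    cap (suc β) (count (_≟ suc (suc β)) a₀) (nonzeroParts a₀) ≤⟨ cap-mono (suc β) maximal (<⇒≤ short) ⟩
    cap (suc β) m s                                         ≡⟨ cap-sucˡ β m s ⟩
    s + cap β m s                                           ∎)
    where open ≤-Reasoning
  r≤cap = remainder≤cap n β s m 1≤s s≤n n∸s≤cap
  g : Vec ℕ (n ∸ s)
  g = greedy β m (n ∸ s) (n ∸ s)
  g-optimal = greedy-optimal β m (n ∸ s) r≤cap
  t-optimal = raisedGreedy-optimal n β s m 1≤s s≤n n∸s≤cap
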